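{- Let $k\ge 2$ and $n\ge 1$ be integers and let $T_k^n$ be the perfect $k$-ary tree of depth $n$. The frugal distinguishing number of $T_k^n$ is $$\operatorname{Fdist}(T_k^n)=\begin{cases}k & \text{if } n=1,\\ k+1 & \text{if } n=2,\\ k+2 & \text{if } n\ge 3.\end{cases}$$
   Context: All graphs are finite and simple. For $k\ge 2$, $n\ge 1$, the perfect $k$-ary tree of depth $n$, denoted $T_k^n$, is the connected acyclic graph with $k^n$ leaves in which one vertex (the root) has degree $k$ and is at distance $n$ from every leaf, and all other internal (non-leaf) vertices have degree $k+1$. A coloring of the vertices of a graph $G$ with $d$ colors (a map from $V(G)$ to a set of $d$ colors, not required to use every color) is $d$-distinguishing if the only automorphism of $G$ preserving the color classes (i.e. mapping each color class to itself) is the trivial one. The distinguishing number $\operatorname{Dist}(G)$ is the smallest $d$ for which $G$ has a $d$-distinguishing coloring. For $d\ge \operatorname{Dist}(G)$, the $d$-paint cost $\rho^d(G)$ is the minimum size of the complement of a color class over all $d$-distinguishing colorings of $G$. A set $S\subseteq V(G)$ is a fixing set for $G$ if the only automorphism of $G$ that fixes every element of $S$ is the trivial one; the fixing number $\operatorname{Fix}(G)$ is the smallest cardinality of a fixing set. The frugal distinguishing number (or frugal number) $\operatorname{Fdist}(G)$ is the smallest $d$ for which $\rho^d(G)=\operatorname{Fix}(G)$. -}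

module Defs where

open import Data.Fin.Base using (Fin)
open import Data.Fin.Permutation using (Permutation′; _⟨$⟩ʳ_)
open import Data.Fin.Properties using () renaming (_≟_ to _≟ᶠ_)
open import Data.Fin.Subset using (Subset; _∈_; ∣_∣; ∁)
open import Data.List.Base using (List; []; _∷_)
open import Data.List.Relation.Unary.Unique.Propositional using (Unique)
open import Data.Nat.Base using (ℕ; zero; suc; _+_; _^_; _≤_)
open import Data.Nat.Properties using (_≟_)
open import Data.Product.Base using (∃; ∃-syntax; _×_)
open import Data.Vec.Base using (tabulate)
open import Function.Bundles using (_⇔_)
open import Relation.Binary.Core using (Rel)
open import Relation.Binary.Definitions using (Decidable; Symmetric; Irreflexive)
open import Relation.Binary.PropositionalEquality.Core using (_≡_; _≢_)
open import Relation.Nullary.Decidable.Core using (does)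
open import Relation.Nullary.Negation.Core using (¬_)
open import Relation.Unary using (Pred) renaming (Decidable to Decidable₁)
open import Level using (0ℓ)

IsLeast : Pred ℕ 0ℓ → Pred ℕ 0ℓ
IsLeast P m = P m × (∀ j → P j → m ≤ j)

comprehension : ∀ {n} {P : Pred (Fin n) 0ℓ} → Decidable₁ P → Subset n
comprehension P? = tabulate (λ v → does (P? v))

-- Finite simple graphs, with vertices numbered so that Data.Fin.Subset
-- supplies cardinalities.  Adj is decidable so that degrees can be counted.
record Graph : Set₁ where
  field
    order  : ℕ
    Adj    : Rel (Fin order) 0ℓ
    adj?   : Decidable Adj
    sym    : Symmetric Adj
    irrefl : Irreflexive _≡_ Adj

  Vertex : Set
  Vertex = Fin order

  degree : Vertex → ℕ
  degree v = ∣ comprehension (adj? v) ∣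

  Leaf : Pred Vertex 0ℓ
  Leaf v = degree v ≡ 1

  leaves : Subset order
  leaves = comprehension (λ v → degree v ≟ 1)

  data Walk : Vertex → Vertex → ℕ → Set where
    stop : ∀ {u} → Walk u u zero
    step : ∀ {u v w m} → Adj u v → Walk v w m → Walk u w (suc m)

  vertices : ∀ {u v m} → Walk u v m → List Vertex
  vertices (stop {u})         = u ∷ []
  vertices (step {u = u} _ p) = u ∷ vertices p

  Connected : Set
  Connected = ∀ u v → ∃ (Walk u v)

  -- A cycle is a path with at least three vertices, closed up by an edge.
  record Cycle : Set where
    field
      {start end} : Vertex
      {len}       : ℕ
      path        : Walk start end len
      distinct    : Unique (vertices path)
      long        : 2 ≤ len
      closing     : Adj end start

  Acyclic : Set
  Acyclic = ¬ Cycle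

  Distance : Vertex → Vertex → ℕ → Set
  Distance u v = IsLeast (Walk u v)

  IsAutomorphism : Pred (Permutation′ order) 0ℓ
  IsAutomorphism σ = ∀ u v → Adj u v ⇔ Adj (σ ⟨$⟩ʳ u) (σ ⟨$⟩ʳ v)

  Trivial : Pred (Permutation′ order) 0ℓ
  Trivial σ = ∀ v → σ ⟨$⟩ʳ v ≡ v

  Coloring : ℕ → Set
  Coloring d = Vertex → Fin d

  colorClass : ∀ {d} → Coloring d → Fin d → Subset order
  colorClass c i = comprehension (λ v → c v ≟ᶠ i)

  Distinguishing : ∀ {d} → Pred (Coloring d) 0ℓ
  Distinguishing c =
    ∀ σ → IsAutomorphism σ → (∀ v → c (σ ⟨$⟩ʳ v) ≡ c v) → Trivial σ

  FixingSet : Pred (Subset order) 0ℓ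
  FixingSet S =
    ∀ σ → IsAutomorphism σ → (∀ v → v ∈ S → σ ⟨$⟩ʳ v ≡ v) → Trivial σ

open Graph public using
  ( Coloring; colorClass; Distinguishing; FixingSet; Connected; Acyclic
  ; degree; Leaf; leaves; Distance; Vertex )

-- The numerical invariants are stated as relations: IsDist G d reads
-- "Dist(G) = d", and similarly for the others.

IsDist : Graph → ℕ → Set
IsDist G = IsLeast (λ d → ∃[ c ] Distinguishing G {d} c)

-- ρᵈ(G) = r, which is only defined when Dist(G) ≤ d.
IsPaintCost : Graph → ℕ → ℕ → Set
IsPaintCost G d r =
  (∃[ d₀ ] IsDist G d₀ × d₀ ≤ d) ×
  IsLeast (λ s → ∃[ c ] Distinguishing G {d} c ×
                 ∃[ i ] ∣ ∁ (colorClass G c i) ∣ ≡ s) r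

IsFix : Graph → ℕ → Set
IsFix G = IsLeast (λ m → ∃[ S ] FixingSet G S × ∣ S ∣ ≡ m)

IsFdist : Graph → ℕ → Set
IsFdist G = IsLeast (λ d → ∃[ r ] IsPaintCost G d r × IsFix G r)

-- "T is the perfect k-ary tree of depth n"; this determines T up to
-- isomorphism when 2 ≤ k and 1 ≤ n.
record IsPerfectTree (k n : ℕ) (T : Graph) : Set where
  field
    connected       : Connected T
    acyclic         : Acyclic T
    leaf-count      : ∣ leaves T ∣ ≡ k ^ n
    root            : Vertex T
    root-degree     : degree T root ≡ k
    root-distance   : ∀ v → Leaf T v → Distance T root v n
    internal-degree : ∀ v → ¬ Leaf T v → v ≢ root → degree T v ≡ k + 1

{-# OPTIONS --safe #-}
module Submission where

-- The tree is first identified with the words of length at most n over Fin k. A fixing set contains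
-- all but at most one leaf of every group of k sibling leaves, since two missing ones could be swapped,
-- so Fix = (k - 1) k^(n-1), and the complement of a colour class of a distinguishing colouring
-- is a fixing set. If it has exactly that size then all inner vertices and one leaf
-- of each group have the neutral colour, and the other leaves of a group have distinct other colours.
-- For n ≥ 2, sibling groups must use different sets of colours, which forces at least k + 1 colours.
-- With k + 1 colours a group is determined by the one colour it omits, so the k groups below a vertex
-- omit each non-neutral colour once; for n ≥ 3 any two siblings at depth n - 2 could then be swapped.
-- With k + 2 colours there are k + 1 types of groups, and inductively k + 1 types of subtrees
-- at every level, the children of a vertex being all types but one.

open import Defs
open import Data.Bool.Base using (true; false)
open import Data.Empty using (⊥)
open import Data.Fin.Base using (Fin; zero; suc; punchIn; punchOut; remQuot; combine)
open import Data.Fin.Permutation using (Permutation′; _⟨$⟩ʳ_; _⟨$⟩ˡ_; inverseˡ; inverseʳ; permutation; flip)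
  renaming (id to idₚ)
open import Data.Fin.Properties
  using (any?; punchIn-punchOut; punchInᵢ≢i; punchIn-injective; punchOut-injective
        ; remQuot-combine; combine-remQuot; injective⇒≤)
  renaming (_≟_ to _≟ᶠ_; suc-injective to sucᶠ-injective)
open import Data.Fin.Subset using (Subset; _∈_; _∉_; ∣_∣; ∁)
open import Data.Fin.Subset.Properties using (_∈?_; x∈∁p⇒x∉p; x∉p⇒x∈∁p)
open import Data.List.Base using (List; []; _∷_; length; _++_; replicate)
open import Data.List.Membership.Propositional using () renaming (_∈_ to _∈ₗ_)
open import Data.List.Properties using (∷-injectiveˡ; ∷-injectiveʳ; ++-cancelʳ; length-++; length-replicate; ≡-dec)
open import Data.List.Relation.Unary.All using (All; []; _∷_)
open import Data.List.Relation.Unary.All.Properties using (¬Any⇒All¬; All¬⇒¬Any)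
open import Data.List.Relation.Unary.AllPairs using ([]; _∷_)
open import Data.List.Relation.Unary.Any using (here; there)
open import Data.List.Relation.Unary.Unique.Propositional using (Unique)
open import Data.Nat.Base using (ℕ; zero; suc; _+_; _*_; _^_; _≤_; _<_; z≤n; s≤s; s≤s⁻¹)
open import Data.Nat.Properties
  using ( _≟_; suc-injective; ≤-trans; ≤-refl; ≤-reflexive; ≤-antisym; n≮n; <⇒≤; <⇒≱; ≰⇒>; m≤n⇒m<n∨m≡n
        ; +-comm; +-suc; +-identityʳ; m≤m+n; m≤n+m; n≤1+n; m+[n∸m]≡n)
open import Data.Product.Base using (∃; ∃₂; ∃-syntax; _×_; _,_; proj₁; proj₂)
open import Data.Sum.Base using (_⊎_; inj₁; inj₂)
open import Data.Vec.Base using ([]; _∷_; here; there)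
open import Data.Vec.Properties using (lookup∘tabulate; []=⇒lookup; lookup⇒[]=)
open import Function.Base using (_∘_)
open import Function.Bundles using (mk⇔; Equivalence)
open import Function.Definitions using (Injective)
open import Level using (0ℓ)
open import Relation.Binary.PropositionalEquality.Core using (_≡_; _≢_; refl; sym; trans; cong; cong₂; subst; subst₂)
open import Relation.Nullary using (Dec; yes; no; ¬_; does; contradiction)
open import Relation.Nullary.Decidable using (dec-true; decidable-stable; ¬?; _×-dec_; _⊎-dec_)
open import Relation.Unary using (Pred) renaming (Decidable to Decidable₁)
open Graph using (Walk; stop; step; vertices; IsAutomorphism; Trivial)

-- Counting with injections into finite subsets

Inj : ∀ {A B : Set} → (A → B) → Set
Inj f = Injective _≡_ _≡_ f

⟨$⟩ʳ-injective : ∀ {m} (σ : Permutation′ m) → Inj (σ ⟨$⟩ʳ_)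
⟨$⟩ʳ-injective σ eq = trans (sym (inverseˡ σ)) (trans (cong (σ ⟨$⟩ˡ_) eq) (inverseˡ σ))

does⁻ : ∀ {A : Set} (a? : Dec A) → does a? ≡ true → A
does⁻ (yes a) _ = a

∈-comprehension⁺ : ∀ {n} {P : Pred (Fin n) 0ℓ} (P? : Decidable₁ P) {v} → P v → v ∈ comprehension P?
∈-comprehension⁺ P? {v} p =
  lookup⇒[]= v _ (trans (lookup∘tabulate _ v) (dec-true (P? v) p))

∈-comprehension⁻ : ∀ {n} {P : Pred (Fin n) 0ℓ} (P? : Decidable₁ P) {v} → v ∈ comprehension P? → P v
∈-comprehension⁻ P? {v} v∈ =
  does⁻ (P? v) (trans (sym (lookup∘tabulate _ v)) ([]=⇒lookup v∈))

enum : ∀ {m} (S : Subset m) → Fin ∣ S ∣ → Fin m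
enum (true ∷ S)  zero    = zero
enum (true ∷ S)  (suc i) = suc (enum S i)
enum (false ∷ S) i       = suc (enum S i)

enum-∈ : ∀ {m} (S : Subset m) i → enum S i ∈ S
enum-∈ (true ∷ S)  zero    = here
enum-∈ (true ∷ S)  (suc i) = there (enum-∈ S i)
enum-∈ (false ∷ S) i       = there (enum-∈ S i)

enum-injective : ∀ {m} (S : Subset m) → Inj (enum S)
enum-injective (true ∷ S)  {zero}  {zero}  _  = refl
enum-injective (true ∷ S)  {suc i} {suc j} eq = cong suc (enum-injective S (sucᶠ-injective eq))
enum-injective (false ∷ S) eq                 = enum-injective S (sucᶠ-injective eq)

enum-onto : ∀ {m} (S : Subset m) {v} → v ∈ S → ∃[ i ] enum S i ≡ v
enum-onto (true ∷ S)  here       = zero , refl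
enum-onto (true ∷ S)  (there v∈) with i , refl ← enum-onto S v∈ = suc i , refl
enum-onto (false ∷ S) (there v∈) with i , refl ← enum-onto S v∈ = i , refl

injective⇒surjective : ∀ {m} (f : Fin m → Fin m) → Inj f → ∀ y → ∃[ x ] f x ≡ y
injective⇒surjective {suc m} f inj y with any? (λ x → f x ≟ᶠ y)
... | yes hit = hit
... | no miss = contradiction (injective⇒≤ λ {a} {b} eq → inj (punchOut-injective (y≢ a) (y≢ b) eq)) (n≮n m)
  where
  y≢ : ∀ x → y ≢ f x
  y≢ x eq = miss (x , sym eq)

surjective⇒≥ : ∀ {m n} (f : Fin m → Fin n) → (∀ y → ∃[ x ] f x ≡ y) → n ≤ m
surjective⇒≥ f sur = injective⇒≤ {f = proj₁ ∘ sur}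
  λ {a} {b} eq → trans (sym (proj₂ (sur a))) (trans (cong f eq) (proj₂ (sur b)))

module _ {m N} (S : Subset m) (f : Fin N → Fin m) (inj : Inj f) (f∈ : ∀ i → f i ∈ S) where

  index : Fin N → Fin ∣ S ∣
  index i = proj₁ (enum-onto S (f∈ i))

  enum-index : ∀ i → enum S (index i) ≡ f i
  enum-index i = proj₂ (enum-onto S (f∈ i))

  index-injective : Inj index
  index-injective {a} {b} eq = inj (trans (sym (enum-index a)) (trans (cong (enum S) eq) (enum-index b)))

  injection-into⇒≤ : N ≤ ∣ S ∣
  injection-into⇒≤ = injective⇒≤ index-injective

injection-into⇒onto : ∀ {m N} (S : Subset m) (f : Fin N → Fin m) → Inj f → (∀ i → f i ∈ S) →
  ∣ S ∣ ≡ N → ∀ {v} → v ∈ S → ∃[ i ] f i ≡ v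
injection-into⇒onto S f inj f∈ refl v∈ =
  let j , eq  = enum-onto S v∈
      i , eq′ = injective⇒surjective (index S f inj f∈) (index-injective S f inj f∈) j
  in i , trans (sym (enum-index S f inj f∈ i)) (trans (cong (enum S) eq′) eq)

cover⇒≤ : ∀ {m N} (S : Subset m) (f : Fin N → Fin m) → (∀ {v} → v ∈ S → ∃[ i ] f i ≡ v) → ∣ S ∣ ≤ N
cover⇒≤ S f cov = injective⇒≤ {f = λ i → proj₁ (cov (enum-∈ S i))} λ {a} {b} eq →
  enum-injective S (trans (sym (proj₂ (cov (enum-∈ S a)))) (trans (cong f eq) (proj₂ (cov (enum-∈ S b)))))

-- If `f i` lay outside `S`, the other N - 1 indices would still cover `S`, which has N elements.
tight-cover⇒∈ : ∀ {m N} (S : Subset m) (f : Fin N → Fin m) → (∀ {v} → v ∈ S → ∃[ i ] f i ≡ v) →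
  ∣ S ∣ ≡ N → ∀ i → ¬ ¬ (f i ∈ S)
tight-cover⇒∈ {N = suc N} S f cov eq i fi∉ = n≮n N (subst (_≤ N) eq (cover⇒≤ S (f ∘ punchIn i) cov′))
  where
  cov′ : ∀ {v} → v ∈ S → ∃[ j ] f (punchIn i j) ≡ v
  cov′ v∈ with j , refl ← cov v∈ = punchOut i≢j , cong f (punchIn-punchOut i≢j)
    where
    i≢j : i ≢ j
    i≢j refl = fi∉ v∈

-- Both functions are bijections onto the complement of z.
injections-match : ∀ {k} (f g : Fin k → Fin (suc k)) → Inj f → Inj g → ∀ z →
  (∀ i → z ≢ f i) → (∀ i → z ≢ g i) →
  ∃[ π ] (∀ i → g (π ⟨$⟩ʳ i) ≡ f i)
injections-match f g f-inj g-inj z z≢f z≢g = permutation to from to-from from-to , λ i → g-onto (f i) (z≢f i)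
  where
  f-sur = injective⇒surjective (λ i → punchOut (z≢f i))
    (λ {a} {b} eq → f-inj (punchOut-injective (z≢f a) (z≢f b) eq))
  g-sur = injective⇒surjective (λ i → punchOut (z≢g i))
    (λ {a} {b} eq → g-inj (punchOut-injective (z≢g a) (z≢g b) eq))
  f⁻ : ∀ y → z ≢ y → _
  f⁻ y z≢y = proj₁ (f-sur (punchOut z≢y))
  g⁻ : ∀ y → z ≢ y → _
  g⁻ y z≢y = proj₁ (g-sur (punchOut z≢y))
  f-onto : ∀ y (z≢y : z ≢ y) → f (f⁻ y z≢y) ≡ y
  f-onto y z≢y = punchOut-injective (z≢f (f⁻ y z≢y)) z≢y (proj₂ (f-sur (punchOut z≢y)))
  g-onto : ∀ y (z≢y : z ≢ y) → g (g⁻ y z≢y) ≡ y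
  g-onto y z≢y = punchOut-injective (z≢g (g⁻ y z≢y)) z≢y (proj₂ (g-sur (punchOut z≢y)))
  to from : Fin _ → Fin _
  to i = g⁻ (f i) (z≢f i)
  from i = f⁻ (g i) (z≢g i)
  to-from : ∀ i → to (from i) ≡ i
  to-from i = g-inj (trans (g-onto (f (from i)) (z≢f (from i))) (f-onto (g i) (z≢g i)))
  from-to : ∀ i → from (to i) ≡ i
  from-to i = f-inj (trans (f-onto (g (to i)) (z≢g (to i))) (g-onto (f i) (z≢f i)))

injection-misses : ∀ {k} (f : Fin k → Fin (suc k)) → ∃[ z ] (∀ i → z ≢ f i)
injection-misses {k} f with any? (λ z → ¬? (any? (λ i → z ≟ᶠ f i)))
... | yes (z , miss) = z , λ i eq → miss (i , eq)
... | no hits = contradiction (surjective⇒≥ f sur) (n≮n k)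
  where
  sur : ∀ y → ∃[ x ] f x ≡ y
  sur y with any? (λ i → y ≟ᶠ f i)
  ... | yes (i , eq) = i , sym eq
  ... | no miss = contradiction (y , miss) hits

-- Words as addresses

-- A vertex of the perfect k-ary tree is addressed by the list of child indices
-- on the path from the root, the deepest index first.
Word : ℕ → Set
Word k = List (Fin k)

_~_ : ∀ {k} → Word k → Word k → Set
x ~ y = (∃[ i ] y ≡ i ∷ x) ⊎ (∃[ i ] x ≡ i ∷ y)

-- Reads the number in base k; the deepest index is the most significant digit.
wordAt : ∀ k m → Fin (k ^ m) → Word k
wordAt k zero    _ = []
wordAt k (suc m) t = proj₁ (remQuot {k} (k ^ m) t) ∷ wordAt k m (proj₂ (remQuot {k} (k ^ m) t))

wordAt-length : ∀ k m t → length (wordAt k m t) ≡ m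
wordAt-length k zero    t = refl
wordAt-length k (suc m) t = cong suc (wordAt-length k m _)

remQuot-injective : ∀ m n {s t : Fin (m * n)} →
  proj₁ (remQuot {m} n s) ≡ proj₁ (remQuot {m} n t) →
  proj₂ (remQuot {m} n s) ≡ proj₂ (remQuot {m} n t) → s ≡ t
remQuot-injective m n {s} {t} eq₁ eq₂ =
  trans (sym (combine-remQuot {m} n s)) (trans (cong₂ combine eq₁ eq₂) (combine-remQuot {m} n t))

wordAt-injective : ∀ k m → Inj (wordAt k m)
wordAt-injective k zero    {zero} {zero} _ = refl
wordAt-injective k (suc m) eq =
  remQuot-injective k (k ^ m) (∷-injectiveˡ eq) (wordAt-injective k m (∷-injectiveʳ eq))

wordAt-onto : ∀ k m (x : Word k) → length x ≡ m → ∃[ t ] wordAt k m t ≡ x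
wordAt-onto k zero    []      _  = zero , refl
wordAt-onto k (suc m) (i ∷ x) eq with t , refl ← wordAt-onto k m x (suc-injective eq) =
  combine i t , cong (λ { (j , s) → j ∷ wordAt k m s }) (remQuot-combine i t)

-- Neighbours and degrees

module Neighbours (G : Graph) where
  open Graph G using (Adj; adj?; irrefl) renaming (sym to adj-sym)

  -- The size `d` is a parameter so that a known degree can be substituted for `degree G v`.
  record Enumerates (v : Vertex G) {d : ℕ} (f : Fin d → Vertex G) : Set where
    field
      injective : Inj f
      edge      : ∀ i → Adj v (f i)
      onto      : ∀ {u} → Adj v u → ∃[ i ] f i ≡ u

  neighbour : ∀ v → Fin (degree G v) → Vertex G
  neighbour v = enum (comprehension (adj? v))

  neighbour-enumerates : ∀ v → Enumerates v (neighbour v)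
  neighbour-enumerates v = record
    { injective = enum-injective (comprehension (adj? v))
    ; edge      = λ i → ∈-comprehension⁻ (adj? v) (enum-∈ _ i)
    ; onto      = λ a → enum-onto _ (∈-comprehension⁺ (adj? v) a)
    }

  module _ (v : Vertex G) where
    open Enumerates (neighbour-enumerates v) public
      renaming (injective to neighbour-injective; edge to neighbour-adj; onto to neighbour-onto)

  leaf-neighbour-unique : ∀ {v} → degree G v ≡ 1 → ∀ {u w} → Adj v u → Adj v w → u ≡ w
  leaf-neighbour-unique {v} deg {u} {w} a b with neighbour-onto v a | neighbour-onto v b
  ... | i , refl | j , refl = cong (neighbour v) (fin1 deg i j)
    where
    fin1 : ∀ {m} → m ≡ 1 → (i j : Fin m) → i ≡ j
    fin1 refl zero zero = refl

  module _ (σ : Permutation′ (Graph.order G)) (auto : IsAutomorphism G σ) where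

    degree-≤ : ∀ v → degree G v ≤ degree G (σ ⟨$⟩ʳ v)
    degree-≤ v = injection-into⇒≤ _ (λ i → σ ⟨$⟩ʳ neighbour v i)
      (neighbour-injective v ∘ ⟨$⟩ʳ-injective σ)
      (λ i → ∈-comprehension⁺ (adj? _) (Equivalence.to (auto _ _) (neighbour-adj v i)))

    degree-≥ : ∀ v → degree G (σ ⟨$⟩ʳ v) ≤ degree G v
    degree-≥ v = injection-into⇒≤ _ (λ i → σ ⟨$⟩ˡ neighbour (σ ⟨$⟩ʳ v) i)
      (neighbour-injective _ ∘ ⟨$⟩ʳ-injective (flip σ))
      (λ i → ∈-comprehension⁺ (adj? _) (Equivalence.from (auto _ _)
        (subst (Adj _) (sym (inverseʳ σ)) (neighbour-adj (σ ⟨$⟩ʳ v) i))))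

    automorphism-degree : ∀ v → degree G (σ ⟨$⟩ʳ v) ≡ degree G v
    automorphism-degree v = ≤-antisym (degree-≥ v) (degree-≤ v)

-- Identifying the tree with the words of length at most n

record Addressing (k n : ℕ) (T : Graph) : Set where
  open Graph T using (Adj)
  field
    vert        : Word k → Vertex T
    code        : Vertex T → Word k
    code-length : ∀ v → length (code v) ≤ n
    vert-code   : ∀ v → vert (code v) ≡ v
    -- On longer words `vert` is unspecified, so it is inverted only up to length n.
    code-vert   : ∀ x → length x ≤ n → code (vert x) ≡ x
    adj⇒~       : ∀ {u v} → Adj u v → code u ~ code v
    ~⇒adj       : ∀ {u v} → code u ~ code v → Adj u v
    fixes-root  : ∀ σ → IsAutomorphism T σ → σ ⟨$⟩ʳ vert [] ≡ vert []

module Address {k n : ℕ} (2≤k : 2 ≤ k) (1≤n : 1 ≤ n) (T : Graph) (perfect : IsPerfectTree k n T) where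
  open Graph T using (Adj; adj?; irrefl) renaming (sym to adj-sym)
  open IsPerfectTree perfect
  open Neighbours T

  -- Cutting a walk at a revisited vertex yields the path of a cycle; the two functions carry over
  -- to the cut walk the facts needed for its distinctness.
  prefix : ∀ {u w m} (p : Walk T u w m) {x} → x ∈ₗ vertices T p →
    ∃₂ λ m′ (p′ : Walk T u x m′) →
      (∀ {P : Vertex T → Set} → All P (vertices T p) → All P (vertices T p′)) ×
      (Unique (vertices T p) → Unique (vertices T p′))
  prefix stop       (here refl) = _ , stop , (λ a → a) , (λ a → a)
  prefix (step a p) (here refl) = _ , stop , (λ { (px ∷ _) → px ∷ [] }) , (λ _ → [] ∷ [])
  prefix (step a p) (there x∈) with _ , p′ , all , uniq ← prefix p x∈ =
    _ , step a p′ , (λ { (px ∷ pxs) → px ∷ all pxs }) , (λ { (px ∷ pxs) → all px ∷ uniq pxs })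

  end∈vertices : ∀ {u w m} (p : Walk T u w m) → w ∈ₗ vertices T p
  end∈vertices stop       = here refl
  end∈vertices (step _ p) = there (end∈vertices p)

  snoc : ∀ {u v w m} → Walk T u v m → Adj v w → Walk T u w (suc m)
  snoc stop       b = step b stop
  snoc (step a p) b = step a (snoc p b)

  -- Non-backtracking walks x, y, … ending at the root.
  data Reduced : Vertex T → Vertex T → Set where
    last : ∀ {x} → Adj x root → Reduced x root
    cons : ∀ {x y z} → Adj x y → x ≢ z → Reduced y z → Reduced x y

  first-edge : ∀ {x y} → Reduced x y → Adj x y
  first-edge (last a)     = a
  first-edge (cons a _ _) = a

  rest : ∀ {x y} → Reduced x y → ∃[ m ] Walk T y root m
  rest (last _)     = _ , stop
  rest (cons _ _ r) = _ , step (first-edge r) (proj₂ (rest r))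

  -- If `x` recurred after `y`, the walk from `y` up to that recurrence, closed by the edge from `x`
  -- to `y`, would be a cycle. It has at least two edges because the walk does not backtrack.
  reduced-distinct : ∀ {x y} (r : Reduced x y) → Unique (x ∷ vertices T (proj₂ (rest r)))
  reduced-distinct (last a) = ((λ { refl → irrefl refl a }) ∷ []) ∷ ([] ∷ [])
  reduced-distinct {x} {y} (cons {z = z} a x≢z r) with reduced-distinct r
  ... | y∉ ∷ uniq = ((λ { refl → irrefl refl a }) ∷ ¬Any⇒All¬ _ x∉) ∷ (y∉ ∷ uniq)
    where
    x∉ : ¬ (x ∈ₗ vertices T (proj₂ (rest r)))
    x∉ x∈ with prefix (proj₂ (rest r)) x∈
    ... | _ , stop , _ = x≢z refl
    ... | _ , p′@(step _ _) , all , uniq′ = acyclic record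
      { path     = step (first-edge r) p′
      ; distinct = all y∉ ∷ uniq′ uniq
      ; long     = s≤s (s≤s z≤n)
      ; closing  = a
      }

  no-reduced-loop : ∀ {y} → ¬ Reduced root y
  no-reduced-loop (last a) = irrefl refl a
  no-reduced-loop r@(cons _ _ _) with reduced-distinct r
  ... | root∉ ∷ _ = All¬⇒¬Any root∉ (end∈vertices (proj₂ (rest r)))

  -- The root counts as its own parent; it is not its own neighbour, so no child is lost.
  Inner : Vertex T → Vertex T → Set
  Inner v p = ¬ Leaf T v × ((v ≢ root × Adj v p) ⊎ (v ≡ root × p ≡ root))

  inner? : ∀ v p → Dec (Inner v p)
  inner? v p = ¬? (degree T v ≟ 1) ×-dec ((¬? (v ≟ᶠ root) ×-dec adj? v p) ⊎-dec (v ≟ᶠ root ×-dec p ≟ᶠ root))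

  record Children (v p : Vertex T) (f : Fin k → Vertex T) : Set where
    constructor children
    field
      injective : Inj f
      edge      : ∀ i → Adj v (f i)
      ≢parent   : ∀ i → f i ≢ p
      onto      : ∀ {u} → Adj v u → u ≢ p → ∃[ i ] f i ≡ u

  inner-children : ∀ {v p} → Inner v p → ∃ (Children v p)
  inner-children (_ , inj₂ (refl , refl)) =
    all-neighbours (subst (λ d → ∃ (Enumerates root {d})) root-degree (_ , neighbour-enumerates root))
    where
    all-neighbours : ∃ (Enumerates root {k}) → ∃ (Children root root)
    all-neighbours (f , enumerates) = f , children injective edge (λ i eq → irrefl (sym eq) (edge i)) (λ a _ → onto a)
      where open Enumerates enumerates
  inner-children {v} {p} (¬leaf , inj₁ (v≢root , v-p)) =
    without-parent (subst (λ d → ∃ (Enumerates v {d}))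
      (trans (internal-degree v ¬leaf v≢root) (+-comm k 1)) (_ , neighbour-enumerates v))
    where
    without-parent : ∃ (Enumerates v {suc k}) → ∃ (Children v p)
    without-parent (f , enumerates) with j , refl ← Enumerates.onto enumerates v-p =
      f ∘ punchIn j , children
        (λ eq → punchIn-injective j _ _ (injective eq))
        (λ i → edge (punchIn j i))
        (λ i eq → punchInᵢ≢i j i (injective eq))
        (λ {u} a u≢p → let i , fi≡u = onto a
                           j≢i = λ j≡i → u≢p (trans (sym fi≡u) (cong f (sym j≡i)))
                       in punchOut j≢i , trans (cong f (punchIn-punchOut j≢i)) fi≡u)
      where open Enumerates enumerates

  child : ∀ {v p} → Dec (Inner v p) → Fin k → Vertex T
  -- A default value that makes `vert` total; `Live` excludes it.
  child {v} (no _)  _ = v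
  child     (yes h) i = proj₁ (inner-children h) i

  vert up : Word k → Vertex T
  vert []      = root
  vert (i ∷ w) = child (inner? (vert w) (up w)) i
  up []        = root
  up (i ∷ w)   = vert w

  vert-children : ∀ w → Inner (vert w) (up w) → Children (vert w) (up w) (λ i → vert (i ∷ w))
  vert-children w h with inner? (vert w) (up w)
  ... | yes h′ = proj₂ (inner-children h′)
  ... | no ¬h  = contradiction h ¬h

  -- All proper ancestors are inner, so every step along the word goes to a genuine child.
  data Live : Word k → Set where
    []  : Live []
    _∷_ : ∀ {i w} → Inner (vert w) (up w) → Live w → Live (i ∷ w)

  module _ (w : Word k) (h : Inner (vert w) (up w)) (i : Fin k) where
    open Children (vert-children w h)
    live-edge : Adj (vert w) (vert (i ∷ w))
    live-edge = edge i
    live-≢up : vert (i ∷ w) ≢ up w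
    live-≢up = ≢parent i

  live-reduced : ∀ {i w} → Live (i ∷ w) → Reduced (vert (i ∷ w)) (vert w)
  live-reduced {i} {[]}    (h ∷ _)         = last (adj-sym (live-edge [] h i))
  live-reduced {i} {w@(_ ∷ _)} (h ∷ l@(_ ∷ _)) = cons (adj-sym (live-edge w h i)) (live-≢up w h i) (live-reduced l)

  live-≢root : ∀ {i w} → Live (i ∷ w) → vert (i ∷ w) ≢ root
  live-≢root l eq = no-reduced-loop (subst (λ v → Reduced v _) eq (live-reduced l))

  -- Such a walk could be prolonged at its start through the ancestors of `w`, one at a time, until
  -- it began at the root.
  no-descent : ∀ {j w} → Live (j ∷ w) → ¬ Reduced (vert w) (vert (j ∷ w))
  no-descent {w = []}    _               r = no-reduced-loop r
  no-descent {j} {w@(i ∷ v)} (h ∷ l@(h′ ∷ _)) r =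
    no-descent l (cons (live-edge v h′ i) (λ eq → live-≢up w h j (sym eq)) r)

  -- Two words with the same vertex but different parents would give a
  -- non-backtracking walk from the root, down one word and up the other.
  live-injective : ∀ {w w′} → Live w → Live w′ → vert w ≡ vert w′ → w ≡ w′
  live-injective []         []          _  = refl
  live-injective []         l′@(_ ∷ _)  eq = contradiction (sym eq) (live-≢root l′)
  live-injective l@(_ ∷ _)  []          eq = contradiction eq (live-≢root l)
  live-injective {i ∷ w} {j ∷ w′} l@(h ∷ lw) l′@(h′ ∷ lw′) eq with vert w ≟ᶠ vert w′
  ... | no ≢ = contradiction
    (cons (live-edge w′ h′ j) (≢ ∘ sym) (subst (λ v → Reduced v (vert w)) eq (live-reduced l)))
    (no-descent l′)
  ... | yes e with refl ← live-injective lw lw′ e = cong (_∷ w) (Children.injective (vert-children w h) eq)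

  live-walk : ∀ {w} → Live w → Walk T root (vert w) (length w)
  live-walk []      = stop
  live-walk {i ∷ w} (h ∷ l) = snoc (live-walk l) (live-edge w h i)

  live-inner : ∀ {w} → Live w → length w < n → Inner (vert w) (up w)
  live-inner {w} l |w|<n = ¬leaf , at-root-or-not l
    where
    ¬leaf : ¬ Leaf T (vert w)
    -- The walk down the word is shorter than the distance n from the root to a leaf.
    ¬leaf leaf = <⇒≱ |w|<n (proj₂ (root-distance _ leaf) _ (live-walk l))
    at-root-or-not : ∀ {w} → Live w → (vert w ≢ root × Adj (vert w) (up w)) ⊎ (vert w ≡ root × up w ≡ root)
    at-root-or-not []        = inj₂ (refl , refl)
    at-root-or-not {i ∷ w} l@(h ∷ _) = inj₁ (live-≢root l , adj-sym (live-edge w h i))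

  live : ∀ w → length w ≤ n → Live w
  live []      _  = []
  live (i ∷ w) le = live-inner (live w (<⇒≤ le)) le ∷ live w (<⇒≤ le)

  inner : ∀ w → length w < n → Inner (vert w) (up w)
  inner w lt = live-inner (live w (<⇒≤ lt)) lt

  Next : Word k → Vertex T → Set
  Next w u = (∃₂ λ i w₀ → w ≡ i ∷ w₀ × u ≡ vert w₀) ⊎ (∃[ i ] length w < n × u ≡ vert (i ∷ w))

  next-inner : ∀ w {u} → length w < n → Adj (vert w) u → Next w u
  next-inner w {u} lt a with u ≟ᶠ up w | inner w lt
  next-inner []       lt a | yes refl | _ = contradiction a (irrefl refl)
  next-inner (i ∷ w₀) lt a | yes refl | _ = inj₁ (i , w₀ , refl , refl)
  next-inner w        lt a | no u≢    | h with i , eq ← Children.onto (vert-children w h) a u≢ =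
    inj₂ (i , lt , sym eq)

  -- Neighbours are understood so far only at depths below n; the length bound keeps every step of
  -- the walk there. This suffices to reach all leaves and so to prove `deep-leaf`, after which
  -- `reach` handles arbitrary walks.
  reach-shallow : ∀ w {u v m} → u ≡ vert w → length w + m ≤ n → Walk T u v m → ∃[ w′ ] length w′ ≤ n × vert w′ ≡ v
  reach-shallow w refl le stop = w , subst (_≤ n) (+-identityʳ _) le , refl
  reach-shallow w {m = suc m} refl le (step a p)
    with next-inner w (≤-trans (s≤s (m≤m+n (length w) m)) (subst (_≤ n) (+-suc (length w) m) le)) a
  ... | inj₁ (i , w₀ , refl , refl) = reach-shallow w₀ refl
    (≤-trans (m≤n+m _ 2) (subst (_≤ n) (cong suc (+-suc (length w₀) m)) le)) p
  ... | inj₂ (i , lt , refl) = reach-shallow (i ∷ w) refl (subst (_≤ n) (+-suc (length w) m) le) p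

  leaf-word : ∀ {v} → Leaf T v → ∃[ w ] length w ≡ n × vert w ≡ v
  leaf-word leaf with reach-shallow [] refl ≤-refl (proj₁ (root-distance _ leaf))
  ... | w , le , refl with m≤n⇒m<n∨m≡n le
  ... | inj₁ lt = contradiction leaf (proj₁ (inner w lt))
  ... | inj₂ eq = w , eq , refl

  -- There are k ^ n leaves, all at depth n, so the k ^ n words of length n are all leaves.
  deep-leaf : ∀ w → length w ≡ n → Leaf T (vert w)
  deep-leaf w eq with t , refl ← wordAt-onto k n w eq =
    decidable-stable (_ ≟ 1) λ ¬leaf →
      tight-cover⇒∈ (leaves T) (vert ∘ wordAt k n) cover leaf-count t
        (¬leaf ∘ ∈-comprehension⁻ (λ v → degree T v ≟ 1))
    where
    cover : ∀ {v} → v ∈ leaves T → ∃[ t ] vert (wordAt k n t) ≡ v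
    cover v∈ with w , eq , refl ← leaf-word (∈-comprehension⁻ (λ v → degree T v ≟ 1) v∈)
             with t , refl ← wordAt-onto k n w eq = t , refl

  next : ∀ w {u} → length w ≤ n → Adj (vert w) u → Next w u
  next w le a with m≤n⇒m<n∨m≡n le
  ... | inj₁ lt = next-inner w lt a
  next []       le a | inj₂ refl = contradiction 1≤n (λ ())
  -- At depth n the vertex is a leaf, so its parent is its only neighbour.
  next (i ∷ w₀) le a | inj₂ eq with live (i ∷ w₀) le
  ... | h ∷ _ = inj₁ (i , w₀ , refl , leaf-neighbour-unique (deep-leaf (i ∷ w₀) eq) a (adj-sym (live-edge w₀ h i)))

  reach : ∀ w {u v m} → u ≡ vert w → length w ≤ n → Walk T u v m → ∃[ w′ ] length w′ ≤ n × vert w′ ≡ v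
  reach w refl le stop = w , le , refl
  reach w refl le (step a p) with next w le a
  ... | inj₁ (_ , w₀ , refl , refl) = reach w₀ refl (<⇒≤ le) p
  ... | inj₂ (i , lt , refl)        = reach (i ∷ w) refl lt p

  word : ∀ v → ∃[ w ] length w ≤ n × vert w ≡ v
  word v = reach [] refl z≤n (proj₂ (connected root v))

  vert-injective : ∀ {w w′} → length w ≤ n → length w′ ≤ n → vert w ≡ vert w′ → w ≡ w′
  vert-injective le le′ = live-injective (live _ le) (live _ le′)

  code : Vertex T → Word k
  code v = proj₁ (word v)

  code-vert : ∀ x → length x ≤ n → code (vert x) ≡ x
  code-vert x le = vert-injective (proj₁ (proj₂ (word (vert x)))) le (proj₂ (proj₂ (word (vert x))))

  adj⇒~ : ∀ {u v} → Adj u v → code u ~ code v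
  adj⇒~ {u} {v} a with word u | word v
  ... | x , x≤ , refl | y , y≤ , refl with next x x≤ a
  ... | inj₁ (i , x₀ , refl , eq) = inj₂ (i , cong (i ∷_) (sym (vert-injective y≤ (<⇒≤ x≤) eq)))
  ... | inj₂ (i , lt , eq)        = inj₁ (i , vert-injective y≤ lt eq)

  ~⇒adj : ∀ {u v} → code u ~ code v → Adj u v
  ~⇒adj {u} {v} x~y with word u | word v
  ~⇒adj (inj₁ (i , refl)) | x , _  , refl | _ , y≤ , refl = live-edge x (inner x y≤) i
  ~⇒adj (inj₂ (i , refl)) | _ , x≤ , refl | y , _  , refl = adj-sym (live-edge y (inner y x≤) i)

  -- All other degrees are 1 or k + 1. Hence automorphisms fix the root.
  degree≡k⇒root : ∀ v → degree T v ≡ k → v ≡ root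
  degree≡k⇒root v deg with v ≟ᶠ root | degree T v ≟ 1
  ... | yes eq | _        = eq
  ... | no ≢   | yes leaf = contradiction (subst (2 ≤_) (trans (sym deg) leaf) 2≤k) λ { (s≤s ()) }
  ... | no ≢   | no ¬leaf = contradiction
    (subst (k <_) (trans (trans (+-comm 1 k) (sym (internal-degree v ¬leaf ≢))) deg) ≤-refl) (n≮n k)

  addressing : Addressing k n T
  addressing = record
    { vert        = vert
    ; code        = code
    ; code-length = λ v → proj₁ (proj₂ (word v))
    ; vert-code   = λ v → proj₂ (proj₂ (word v))
    ; code-vert   = code-vert
    ; adj⇒~       = adj⇒~
    ; ~⇒adj       = ~⇒adj
    ; fixes-root  = λ σ auto → degree≡k⇒root _ (trans (automorphism-degree σ auto root) root-degree)
    }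

-- Exchanging the subtrees at two siblings

module Locally {k : ℕ} (P : Word k → Permutation′ k) where

  -- `P e` permutes the children of the node `e` of the source tree; the inverse must therefore look
  -- `P` up at the address already translated back.
  act unact : Word k → Word k
  act []        = []
  act (i ∷ e)   = (P e ⟨$⟩ʳ i) ∷ act e
  unact []      = []
  unact (j ∷ e) = (P (unact e) ⟨$⟩ˡ j) ∷ unact e

  unact-act : ∀ e → unact (act e) ≡ e
  unact-act []      = refl
  unact-act (i ∷ e) rewrite unact-act e = cong (_∷ e) (inverseˡ (P e))

  act-unact : ∀ e → act (unact e) ≡ e
  act-unact []      = refl
  act-unact (j ∷ e) = cong₂ _∷_ (inverseʳ (P (unact e))) (act-unact e)

  length-act : ∀ e → length (act e) ≡ length e
  length-act []      = refl
  length-act (i ∷ e) = cong suc (length-act e)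

  length-unact : ∀ e → length (unact e) ≡ length e
  length-unact []      = refl
  length-unact (i ∷ e) = cong suc (length-unact e)

length-above : ∀ {k} (e e′ : Word k) {a b w} → length e ≡ length e′ →
  length (e ++ a ∷ w) ≡ length (e′ ++ b ∷ w)
length-above e e′ eq =
  trans (length-++ e) (trans (cong (_+ _) eq) (sym (length-++ e′)))

not-above-itself : ∀ {k} (e : Word k) {b w} → w ≢ e ++ b ∷ w
not-above-itself e {b} {w} eq = n≮n (length w)
  (≤-trans (m≤n+m (suc (length w)) (length e)) (≤-reflexive (sym (trans (cong length eq) (length-++ e)))))

-- Makes the subtrees at different siblings disjoint; unequal offsets are ruled out by length.
above-siblings : ∀ {k} (e e′ : Word k) {a b w} → e ++ a ∷ w ≡ e′ ++ b ∷ w → a ≡ b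
above-siblings []      []       eq = ∷-injectiveˡ eq
above-siblings []      (_ ∷ e′) eq = contradiction (∷-injectiveʳ eq) (not-above-itself e′)
above-siblings (_ ∷ e) []       eq = contradiction (sym (∷-injectiveʳ eq)) (not-above-itself e)
above-siblings (_ ∷ e) (_ ∷ e′) eq = above-siblings e e′ (∷-injectiveʳ eq)

-- Exchanges the subtrees at the siblings a ∷ w and b ∷ w along the isomorphism act P.
module Swap {k : ℕ} {a b : Fin k} (a≢b : a ≢ b) (w : Word k) (P : Word k → Permutation′ k) where
  open Locally P

  data Place : Word k → Set where
    inA : ∀ e → Place (e ++ a ∷ w)
    inB : ∀ e → Place (e ++ b ∷ w)
    out : ∀ {x} → (∀ e → x ≢ e ++ a ∷ w) → (∀ e → x ≢ e ++ b ∷ w) → Place x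

  -- A child of a word inside one of the subtrees stays inside; a child of a word outside both can
  -- enter only at `a ∷ w` or `b ∷ w`.
  place-∷ : ∀ i {x} → Place x → Place (i ∷ x)
  place-∷ i (inA e) = inA (i ∷ e)
  place-∷ i (inB e) = inB (i ∷ e)
  place-∷ i {x} (out ∉A ∉B) with ≡-dec _≟ᶠ_ (i ∷ x) (a ∷ w) | ≡-dec _≟ᶠ_ (i ∷ x) (b ∷ w)
  ... | yes refl | _        = inA []
  ... | no _     | yes refl = inB []
  ... | no ≢A    | no ≢B    = out
    (λ { [] eq → ≢A eq ; (_ ∷ e) eq → ∉A e (∷-injectiveʳ eq) })
    (λ { [] eq → ≢B eq ; (_ ∷ e) eq → ∉B e (∷-injectiveʳ eq) })

  place : ∀ x → Place x
  place []      = out (λ { [] () ; (_ ∷ _) () }) (λ { [] () ; (_ ∷ _) () })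
  place (i ∷ x) = place-∷ i (place x)

  move : ∀ {x} → Place x → Word k
  move (inA e)       = act e ++ b ∷ w
  move (inB e)       = unact e ++ a ∷ w
  move (out {x} _ _) = x

  -- The cases of `Place` exclude each other, so `place x` may be replaced by whichever place makes
  -- `move` compute.
  move-unique : ∀ {x y} → x ≡ y → (p : Place x) (q : Place y) → move p ≡ move q
  move-unique eq (inA e)      (inA e′)     = cong (λ e → act e ++ b ∷ w) (++-cancelʳ (a ∷ w) e e′ eq)
  move-unique eq (inB e)      (inB e′)     = cong (λ e → unact e ++ a ∷ w) (++-cancelʳ (b ∷ w) e e′ eq)
  move-unique eq (inA e)      (inB e′)     = contradiction (above-siblings e e′ eq) a≢b
  move-unique eq (inB e)      (inA e′)     = contradiction (sym (above-siblings e e′ eq)) a≢b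
  move-unique eq (inA e)      (out ∉A _)   = contradiction (sym eq) (∉A e)
  move-unique eq (inB e)      (out _ ∉B)   = contradiction (sym eq) (∉B e)
  move-unique eq (out ∉A _)   (inA e)      = contradiction eq (∉A e)
  move-unique eq (out _ ∉B)   (inB e)      = contradiction eq (∉B e)
  move-unique eq (out _ _)    (out _ _)    = eq

  swap : Word k → Word k
  swap x = move (place x)

  swap-move : ∀ {x} (p : Place x) → swap (move p) ≡ x
  swap-move (inA e)       = trans (move-unique refl (place _) (inB (act e))) (cong (_++ a ∷ w) (unact-act e))
  swap-move (inB e)       = trans (move-unique refl (place _) (inA (unact e))) (cong (_++ b ∷ w) (act-unact e))
  swap-move p@(out _ _)   = move-unique refl (place _) p

  length-move : ∀ {x} (p : Place x) → length (move p) ≡ length x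
  length-move (inA e)   = length-above (act e) e (length-act e)
  length-move (inB e)   = length-above (unact e) e (length-unact e)
  length-move (out _ _) = refl

  -- Adjacency is the relation of parent and child, so this is all that an automorphism requires of
  -- `swap`.
  move-child : ∀ i {x} (p : Place x) → ∃[ j ] move (place-∷ i p) ≡ j ∷ move p
  move-child i (inA e) = _ , refl
  move-child i (inB e) = _ , refl
  move-child i {x} (out ∉A ∉B) with ≡-dec _≟ᶠ_ (i ∷ x) (a ∷ w) | ≡-dec _≟ᶠ_ (i ∷ x) (b ∷ w)
  ... | yes refl | _        = b , refl
  ... | no _     | yes refl = a , refl
  ... | no _     | no _     = i , refl

  swap-~ : ∀ {x y} → x ~ y → swap x ~ swap y
  swap-~ {x} (inj₁ (i , refl))     = inj₁ (move-child i (place x))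
  swap-~ {y = y} (inj₂ (i , refl)) = inj₂ (move-child i (place y))

-- Automorphisms of the addressed tree

module Automorphisms {k n : ℕ} {T : Graph} (A : Addressing k n T) where
  open Graph T using (Adj)
  open Addressing A

  code-injective : ∀ {u v} → code u ≡ code v → u ≡ v
  code-injective eq = trans (sym (vert-code _)) (trans (cong vert eq) (vert-code _))

  -- An involution is its own inverse, and preserving length keeps it within the words that address
  -- vertices.
  involution-automorphism : (h : Word k → Word k) → (∀ x → h (h x) ≡ x) →
    (∀ x → length (h x) ≡ length x) → (∀ {x y} → x ~ y → h x ~ h y) →
    ∃[ σ ] IsAutomorphism T σ × (∀ v → code (σ ⟨$⟩ʳ v) ≡ h (code v))
  involution-automorphism h invol len h-~ = permutation f f f-invol f-invol , auto , code-f
    where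
    f : Vertex T → Vertex T
    f v = vert (h (code v))
    code-f : ∀ v → code (f v) ≡ h (code v)
    code-f v = code-vert _ (subst (_≤ n) (sym (len (code v))) (code-length v))
    f-invol : ∀ v → f (f v) ≡ v
    f-invol v = code-injective (trans (code-f (f v)) (trans (cong h (code-f v)) (invol (code v))))
    f-adj : ∀ {u v} → Adj u v → Adj (f u) (f v)
    f-adj {u} {v} a = ~⇒adj (subst₂ _~_ (sym (code-f u)) (sym (code-f v)) (h-~ (adj⇒~ a)))
    auto : ∀ u v → _
    auto u v = mk⇔ f-adj (λ a → subst₂ Adj (f-invol u) (f-invol v) (f-adj a))

  module _ {a b : Fin k} (a≢b : a ≢ b) (w : Word k) (≤n : suc (length w) ≤ n) where

    module _ (P : Word k → Permutation′ k) where
      open Swap a≢b w P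
      open Locally P

      swap-automorphism : ∃[ σ ] IsAutomorphism T σ × (∀ v → code (σ ⟨$⟩ʳ v) ≡ swap (code v))
      swap-automorphism = involution-automorphism swap (λ x → swap-move (place x)) (λ x → length-move (place x)) swap-~

      swap-nontrivial : ¬ Trivial T (proj₁ swap-automorphism)
      swap-nontrivial trivial = a≢b (∷-injectiveˡ (trans a∷w≡swap (move-unique refl (place (a ∷ w)) (inA []))))
        where
        a∷w≡swap : a ∷ w ≡ swap (a ∷ w)
        a∷w≡swap = trans (sym (code-vert (a ∷ w) ≤n))
                     (trans (cong code (sym (trivial (vert (a ∷ w)))))
                        (trans (proj₂ (proj₂ swap-automorphism) _) (cong swap (code-vert (a ∷ w) ≤n))))

      -- The subtree at `b ∷ w` needs no separate check: there the swap inverts the one from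
      -- `a ∷ w`.
      swap-invariant : ∀ {C : Set} (f : Word k → C) →
        (∀ e → length (e ++ a ∷ w) ≤ n → f (act e ++ b ∷ w) ≡ f (e ++ a ∷ w)) →
        ∀ x → length x ≤ n → f (swap x) ≡ f x
      swap-invariant f inv x x≤n = go (place x) x≤n
        where
        go : ∀ {x} (p : Place x) → length x ≤ n → f (move p) ≡ f x
        go (inA e)   le = inv e le
        go (inB e)   le = trans (sym (inv (unact e) (subst (_≤ n) (length-above e (unact e) (sym (length-unact e))) le)))
                                (cong (λ e → f (e ++ b ∷ w)) (act-unact e))
        go (out _ _) le = refl

    -- The source of all lower bounds: an isomorphism `act P` between sibling subtrees that
    -- respected colours would give a nontrivial colour-preserving swap.
    siblings-differ : ∀ {d} (c : Coloring T d) → Distinguishing T c → (P : Word k → Permutation′ k) →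
      ¬ (∀ e → length (e ++ a ∷ w) ≤ n → c (vert (Locally.act P e ++ b ∷ w)) ≡ c (vert (e ++ a ∷ w)))
    siblings-differ c dist P inv =
      swap-nontrivial P (dist (proj₁ swapping) (proj₁ (proj₂ swapping)) λ v →
        trans (cong c (trans (sym (vert-code _)) (cong vert (proj₂ (proj₂ swapping) v))))
          (trans (swap-invariant P (c ∘ vert) inv (code v) (code-length v)) (cong c (vert-code v))))
      where swapping = swap-automorphism P

    -- Nothing lies below the two leaves, so swapping them moves no other vertex.
    fixing-set-meets-sibling-leaves : suc (length w) ≡ n → ∀ (S : Subset (Graph.order T)) → FixingSet T S →
      vert (a ∷ w) ∉ S → vert (b ∷ w) ∈ S
    fixing-set-meets-sibling-leaves w≡n S fixing a∉ = decidable-stable (_ ∈? S) λ b∉ →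
      swap-nontrivial P (fixing σ auto λ v v∈ →
        code-injective (trans (code-σ v) (go (place (code v)) (code-length v) λ where
        (inj₁ eq) → a∉ (subst (_∈ S) (trans (sym (vert-code v)) (cong vert eq)) v∈)
        (inj₂ eq) → b∉ (subst (_∈ S) (trans (sym (vert-code v)) (cong vert eq)) v∈))))
      where
      P : Word k → Permutation′ k
      P _ = idₚ
      open Swap a≢b w P
      σ = proj₁ (swap-automorphism P)
      auto = proj₁ (proj₂ (swap-automorphism P))
      code-σ = proj₂ (proj₂ (swap-automorphism P))
      too-long : ∀ i e {j} → ¬ (length (i ∷ e ++ j ∷ w) ≤ n)
      too-long i e {j} le = n≮n n (≤-trans (s≤s (subst (_≤ length (e ++ j ∷ w)) w≡n
        (subst (suc (length w) ≤_) (sym (length-++ e)) (m≤n+m (suc (length w)) (length e))))) le)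
      go : ∀ {x} (p : Place x) → length x ≤ n → ¬ (x ≡ a ∷ w ⊎ x ≡ b ∷ w) → move p ≡ x
      go (inA [])      _  ≢ = contradiction (inj₁ refl) ≢
      go (inA (i ∷ e)) le _ = contradiction le (too-long i e)
      go (inB [])      _  ≢ = contradiction (inj₂ refl) ≢
      go (inB (i ∷ e)) le _ = contradiction le (too-long i e)
      go (out _ _)     _  _ = refl

  -- R x y is a necessary condition, computed from the leaves upwards, for a
  -- colour-preserving automorphism to map x to y.
  distinguishing : ∀ {d} (col : Word k → Fin d) (R : Word k → Word k → Set) →
    (∀ x y → length x ≡ length y → length x ≤ n → col x ≡ col y →
      (length x < n → ∀ i → ∃[ j ] R (i ∷ x) (j ∷ y)) → R x y) →
    (∀ x i j → suc (length x) ≤ n → R (i ∷ x) (j ∷ x) → i ≡ j) →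
    Distinguishing T (col ∘ code)
  distinguishing col R up separates σ auto col-σ v =
    code-injective (trans (cong (code ∘ (σ ⟨$⟩ʳ_)) (sym (vert-code v))) (h-id (code v) (code-length v)))
    where
    h : Word k → Word k
    h x = code (σ ⟨$⟩ʳ vert x)

    h-root : h [] ≡ []
    h-root = trans (cong code (fixes-root σ auto)) (code-vert [] z≤n)

    h-injective : ∀ {x y} → length x ≤ n → length y ≤ n → h x ≡ h y → x ≡ y
    h-injective {x} {y} x≤ y≤ eq = trans (sym (code-vert x x≤)) (trans (cong code
      (⟨$⟩ʳ-injective σ (code-injective eq))) (code-vert y y≤))

    h-~ : ∀ {x y} → length x ≤ n → length y ≤ n → x ~ y → h x ~ h y
    h-~ {x} {y} x≤ y≤ x~y = adj⇒~ (Equivalence.to (auto (vert x) (vert y))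
      (~⇒adj (subst₂ _~_ (sym (code-vert x x≤)) (sym (code-vert y y≤)) x~y)))

    h-child : ∀ i x → suc (length x) ≤ n → ∃[ j ] h (i ∷ x) ≡ j ∷ h x
    h-child i x le with h-~ (<⇒≤ le) le (inj₁ (i , refl))
    ... | inj₁ down = down
    h-child i []       le | inj₂ (j , eq) = contradiction (trans (sym h-root) eq) λ ()
    -- If the image were the parent of `h (i′ ∷ x)`, it would be `h x`, contradicting injectivity.
    h-child i (i′ ∷ x) le | inj₂ (j , eq) with h-child i′ x (<⇒≤ le)
    ... | j′ , eq′ = contradiction
      (cong length (h-injective le (<⇒≤ (<⇒≤ le)) (∷-injectiveʳ (trans (sym eq) eq′))))
      λ len → n≮n _ (≤-trans (s≤s (m≤n+m (length x) 1)) (≤-reflexive len))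

    h-length : ∀ x → length x ≤ n → length (h x) ≡ length x
    h-length []      _  = cong length h-root
    h-length (i ∷ x) le = trans (cong length (proj₂ (h-child i x le))) (cong suc (h-length x (<⇒≤ le)))

    -- Induction on the height `m` above the leaf level.
    R-h : ∀ m x → length x + m ≡ n → R x (h x)
    R-h m x eq = up x (h x) (sym (h-length x x≤)) x≤
      (trans (cong col (sym (code-vert x x≤))) (sym (col-σ (vert x)))) (below m eq)
      where
      x≤ = subst (length x ≤_) eq (m≤m+n (length x) m)
      below : ∀ m → length x + m ≡ n → length x < n → ∀ i → ∃[ j ] R (i ∷ x) (j ∷ h x)
      below zero    eq lt i = contradiction (subst (length x <_) (trans (sym eq) (+-identityʳ _)) lt) (n≮n _)
      below (suc m) eq lt i with j , eq′ ← h-child i x lt =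
        j , subst (R (i ∷ x)) eq′ (R-h m (i ∷ x) (trans (sym (+-suc (length x) m)) eq))

    -- Induction from the root downwards: once `x` is fixed, `R` relates two of its children, and
    -- `separates` identifies them.
    h-id : ∀ x → length x ≤ n → h x ≡ x
    h-id []      _  = h-root
    h-id (i ∷ x) le with j , eq ← h-child i x le =
      trans eq (trans (cong (j ∷_) x-fixed) (cong (_∷ x) (sym (separates x i j le
        (subst (R (i ∷ x)) (trans eq (cong (j ∷_) x-fixed)) (R-h _ (i ∷ x) (m+[n∸m]≡n le)))))))
      where
      x-fixed = h-id x (<⇒≤ le)

-- Complements of colour classes

module ColourClasses {G : Graph} {d} (c : Coloring G d) (i : Fin d) where

  ∈∁class⁺ : ∀ {v} → c v ≢ i → v ∈ ∁ (colorClass G c i)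
  ∈∁class⁺ c≢i = x∉p⇒x∈∁p (c≢i ∘ ∈-comprehension⁻ (λ v → c v ≟ᶠ i))

  ∈∁class⁻ : ∀ {v} → v ∈ ∁ (colorClass G c i) → c v ≢ i
  ∈∁class⁻ v∈ c≡i = x∈∁p⇒x∉p v∈ (∈-comprehension⁺ (λ v → c v ≟ᶠ i) c≡i)

  -- An automorphism fixing all vertices outside the class cannot, being injective, move a vertex of
  -- the class out of it; so it preserves colours.
  ∁class-fixing : Distinguishing G c → FixingSet G (∁ (colorClass G c i))
  ∁class-fixing dist σ auto fixes = dist σ auto c-σ
    where
    c-σ : ∀ v → c (σ ⟨$⟩ʳ v) ≡ c v
    c-σ v with c v ≟ᶠ i | c (σ ⟨$⟩ʳ v) ≟ᶠ i
    ... | no  cv≢i | _         = cong c (fixes v (∈∁class⁺ cv≢i))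
    ... | yes cv≡i | yes cσv≡i = trans cσv≡i (sym cv≡i)
    ... | yes _    | no  cσv≢i = cong c (⟨$⟩ʳ-injective σ (fixes _ (∈∁class⁺ cσv≢i)))

-- Fixing sets and distinguishing colourings of least cost

module Frugal {q m : ℕ} {T : Graph} (A : Addressing (suc q) (suc m) T) where
  open Addressing A
  open Automorphisms A

  -- `N` will be the fixing number: k - 1 leaves from each of the k ^ (n - 1) sibling groups.
  k n N : ℕ
  k = suc q
  n = suc m
  N = k ^ m * q

  vert-injective : ∀ {x y} → length x ≤ n → length y ≤ n → vert x ≡ vert y → x ≡ y
  vert-injective x≤ y≤ eq = trans (sym (code-vert _ x≤)) (trans (cong code eq) (code-vert _ y≤))

  group : Fin (k ^ m) → Word k
  group = wordAt k m

  group-≤ : ∀ i s → length (i ∷ group s) ≤ n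
  group-≤ i s = ≤-reflexive (cong suc (wordAt-length k m s))

  module Fixing (S : Subset (Graph.order T)) (fixing : FixingSet T S) where

    exempt : ∀ s → ∃[ e ] (∀ i → i ≢ e → vert (i ∷ group s) ∈ S)
    exempt s with any? (λ i → ¬? (vert (i ∷ group s) ∈? S))
    ... | yes (e , e∉) = e , λ i i≢e → fixing-set-meets-sibling-leaves (i≢e ∘ sym) (group s) (group-≤ e s)
      (cong suc (wordAt-length k m s)) S fixing e∉
    -- If the whole group lies in `S`, any leaf may be declared exempt.
    ... | no all∈ = zero , λ i _ → decidable-stable (_ ∈? S) (λ i∉ → all∈ (i , i∉))

    kept : Fin (k ^ m) → Fin q → Word k
    kept s j = punchIn (proj₁ (exempt s)) j ∷ group s

    kept-length : ∀ s j → length (kept s j) ≡ n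
    kept-length s j = cong suc (wordAt-length k m s)

    kept-injective : ∀ {s t i j} → kept s i ≡ kept t j → s ≡ t × i ≡ j
    kept-injective {s} eq with refl ← wordAt-injective k m (∷-injectiveʳ eq) =
      refl , punchIn-injective (proj₁ (exempt s)) _ _ (∷-injectiveˡ eq)

    keptAt : Fin N → Word k
    keptAt t = kept (proj₁ (remQuot {k ^ m} q t)) (proj₂ (remQuot {k ^ m} q t))

    keptAt-≤ : ∀ t → length (keptAt t) ≤ n
    keptAt-≤ t = ≤-reflexive (kept-length (proj₁ (remQuot {k ^ m} q t)) (proj₂ (remQuot {k ^ m} q t)))

    pick : Fin N → Vertex T
    pick t = vert (keptAt t)

    pick-injective : Inj pick
    pick-injective {s} {t} eq = remQuot-injective (k ^ m) q (proj₁ same) (proj₂ same)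
      where same = kept-injective (vert-injective (keptAt-≤ s) (keptAt-≤ t) eq)

    kept-∈ : ∀ s j → vert (kept s j) ∈ S
    kept-∈ s j = proj₂ (exempt s) _ (punchInᵢ≢i (proj₁ (exempt s)) j)

    pick-∈ : ∀ t → pick t ∈ S
    pick-∈ t = kept-∈ (proj₁ (remQuot {k ^ m} q t)) (proj₂ (remQuot {k ^ m} q t))

    N≤∣S∣ : N ≤ ∣ S ∣
    N≤∣S∣ = injection-into⇒≤ S pick pick-injective pick-∈

    module Minimal (∣S∣≡N : ∣ S ∣ ≡ N) where

      -- With exactly N elements in `S`, the injection `pick` is onto, so `S` consists of the kept
      -- leaves alone.
      ∈S⇒kept : ∀ {x} → length x ≤ n → vert x ∈ S → ∃₂ λ s j → x ≡ kept s j
      ∈S⇒kept x≤ x∈ = let t , eq = injection-into⇒onto S pick pick-injective pick-∈ ∣S∣≡N x∈ in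
        proj₁ (remQuot {k ^ m} q t) , proj₂ (remQuot {k ^ m} q t) , sym (vert-injective (keptAt-≤ t) x≤ eq)

      inner∉S : ∀ {x} → length x < n → vert x ∉ S
      inner∉S lt x∈ = let s , j , eq = ∈S⇒kept (<⇒≤ lt) x∈ in
        n≮n n (subst (_< n) (trans (cong length eq) (kept-length s j)) lt)

      kept-≢exempt : ∀ {s s′ j} → proj₁ (exempt s) ∷ group s ≢ kept s′ j
      kept-≢exempt {s} {s′} {j} eq with refl ← wordAt-injective k m {s} {s′} (∷-injectiveʳ eq) =
        punchInᵢ≢i (proj₁ (exempt s)) j (sym (∷-injectiveˡ eq))

      exempt∉S : ∀ s → vert (proj₁ (exempt s) ∷ group s) ∉ S
      exempt∉S s x∈ = let s′ , j , eq = ∈S⇒kept (group-≤ (proj₁ (exempt s)) s) x∈ in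
        kept-≢exempt {s} {s′} {j} eq

  module Coloured {d} (c : Coloring T d) (dist : Distinguishing T c) where

    leaf-colour : Word k → Fin k → Fin d
    leaf-colour x i = c (vert (i ∷ x))

    leaf-colour-injective : ∀ x → length x ≡ m → Inj (leaf-colour x)
    leaf-colour-injective x eq {a} {b} same = decidable-stable (a ≟ᶠ b) λ a≢b →
      siblings-differ a≢b x (≤-reflexive (cong suc eq)) c dist (λ _ → idₚ) λ
        { []      _  → sym same
        ; (i ∷ e) le → contradiction le (too-deep i e) }
      where
      too-deep : ∀ i e → ¬ (length (i ∷ e ++ a ∷ x) ≤ n)
      too-deep i e (s≤s le) = n≮n m (≤-trans (subst (λ l → suc l ≤ suc (length x)) eq ≤-refl)
        (≤-trans (m≤n+m (suc (length x)) (length e)) (subst (_≤ m) (length-++ e) le)))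

    k≤d : k ≤ d
    -- Any group of sibling leaves would do; this one lies below the all-zero word.
    k≤d = injective⇒≤ (leaf-colour-injective (replicate m zero) (length-replicate m))

    module Neutral (o : Fin d) (minimal : ∣ ∁ (colorClass T c o) ∣ ≡ N) where
      open ColourClasses {T} c o
      open Fixing (∁ (colorClass T c o)) (∁class-fixing dist)
      open Minimal minimal

      neutral : ∀ {v} → v ∉ ∁ (colorClass T c o) → c v ≡ o
      neutral {v} v∉ = decidable-stable (c v ≟ᶠ o) (v∉ ∘ ∈∁class⁺)

      inner-neutral : ∀ x → length x < n → c (vert x) ≡ o
      inner-neutral x lt = neutral (inner∉S lt)

      neutral-leaf : ∀ x → length x ≡ m → ∃[ j ] leaf-colour x j ≡ o
      neutral-leaf x eq with s , refl ← wordAt-onto k m x eq = proj₁ (exempt s) , neutral (exempt∉S s)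

      -- The parents are neutral, so a matching of their leaf colours would allow the two groups to
      -- be exchanged.
      groups-differ : ∀ {a b} → a ≢ b → ∀ w → suc (length w) ≡ m → (π : Permutation′ k) →
        ¬ (∀ i → leaf-colour (b ∷ w) (π ⟨$⟩ʳ i) ≡ leaf-colour (a ∷ w) i)
      groups-differ {a} {b} a≢b w refl π match = siblings-differ a≢b w (n≤1+n _) c dist P λ
        { []              _  → trans (inner-neutral _ ≤-refl) (sym (inner-neutral _ ≤-refl))
        ; (i ∷ [])        _  → match i
        ; (i ∷ j ∷ e)     le → contradiction le (too-deep e)
        }
        where
        P : Word k → Permutation′ k
        P []      = π
        P (_ ∷ _) = idₚ
        too-deep : ∀ e → ¬ (suc (suc (length (e ++ a ∷ w))) ≤ n)
        too-deep e (s≤s le) = n≮n m (≤-trans (s≤s (m≤n+m m (length e))) (subst (λ l → suc l ≤ m) (length-++ e) le))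

-- Lower bounds on the number of colours

module _ {q m : ℕ} {T : Graph} (A : Addressing (suc (suc q)) (suc m) T) where
  open Addressing A
  open Automorphisms A
  open Frugal A

  -- Injectivity forces d = k; adding a spare colour `zero` makes both images the complement of one
  -- point, as `injections-match` expects.
  two-colourings-match : ∀ {d} → d ≤ k → (f g : Fin k → Fin d) → Inj f → Inj g →
    ∃[ π ] (∀ i → g (π ⟨$⟩ʳ i) ≡ f i)
  two-colourings-match d≤k f g f-inj g-inj with refl ← ≤-antisym d≤k (injective⇒≤ f-inj)
    with π , match ← injections-match (suc ∘ f) (suc ∘ g) (f-inj ∘ sucᶠ-injective) (g-inj ∘ sucᶠ-injective)
                       zero (λ _ ()) (λ _ ()) =
    π , sucᶠ-injective ∘ match

  -- With at most k colours, two sibling groups use the same colour set and can be exchanged.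
  more-than-k : ∀ {d} (c : Coloring T d) → Distinguishing T c → (o : Fin d) →
    ∣ ∁ (colorClass T c o) ∣ ≡ N → 1 ≤ m → k < d
  more-than-k {d} c dist o minimal (s≤s {n = m′} _) = ≰⇒> λ d≤k →
    let w          = replicate m′ zero
        w≡         = cong suc (length-replicate m′)
        π , match  = two-colourings-match d≤k (leaf-colour (zero ∷ w)) (leaf-colour (suc zero ∷ w))
                       (leaf-colour-injective _ w≡) (leaf-colour-injective _ w≡)
    in groups-differ (λ ()) w w≡ π match
    where
    open Coloured c dist
    open Neutral o minimal

  not-suc-k : (c : Coloring T (suc k)) → Distinguishing T c → (o : Fin (suc k)) →
    ∣ ∁ (colorClass T c o) ∣ ≡ N → (u : Word k) → ¬ 2 + length u ≡ m
  not-suc-k c dist o minimal u w≡ =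
    siblings-differ {a = zero} {b = suc zero} (λ ()) u (≤-trans (m≤n+m _ 2) deep) c dist P λ
      { []              _  → trans (inner-neutral _ high) (sym (inner-neutral _ high))
      ; (j ∷ [])        _  → trans (inner-neutral _ deep) (sym (inner-neutral _ deep))
      ; (i ∷ j ∷ [])    _  → proj₂ (same-missing j) i
      ; (_ ∷ _ ∷ _ ∷ e) le → contradiction le (too-deep e)
      }
    where
    open Coloured c dist
    open Neutral o minimal
    deep : 3 + length u ≤ n
    deep = ≤-reflexive (cong suc w≡)

    high : 2 + length u ≤ n
    high = <⇒≤ deep

    too-deep : ∀ e → ¬ (3 + length (e ++ zero ∷ u) ≤ n)
    too-deep e le = n≮n (3 + length (e ++ zero ∷ u)) (≤-trans (s≤s le) (≤-trans (≤-reflexive (cong (2 +_) (sym w≡)))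
      (s≤s (s≤s (s≤s (subst (suc (length u) ≤_) (sym (length-++ e)) (m≤n+m (suc (length u)) (length e))))))))

    missing : Word k → Fin (suc k)
    missing x = proj₁ (injection-misses (leaf-colour x))

    missing-≢ : ∀ x i → missing x ≢ leaf-colour x i
    missing-≢ x = proj₂ (injection-misses (leaf-colour x))

    match : ∀ x y → length x ≡ m → length y ≡ m → missing x ≡ missing y →
      ∃[ π ] (∀ i → leaf-colour y (π ⟨$⟩ʳ i) ≡ leaf-colour x i)
    match x y x≡ y≡ eq = injections-match (leaf-colour x) (leaf-colour y)
      (leaf-colour-injective x x≡) (leaf-colour-injective y y≡) (missing x) (missing-≢ x)
      (subst (λ z → ∀ i → z ≢ leaf-colour y i) (sym eq) (missing-≢ y))

    -- With k + 1 colours the missing one determines the colour set of a group, so equal values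
    -- would match two sibling groups.
    missing-injective : ∀ w → suc (length w) ≡ m → Inj (λ i → missing (i ∷ w))
    missing-injective w w≡ {a} {b} eq = decidable-stable (a ≟ᶠ b) λ a≢b →
      let π , same = match (a ∷ w) (b ∷ w) w≡ w≡ eq in groups-differ a≢b w w≡ π same

    missing-≢o : ∀ x → length x ≡ m → o ≢ missing x
    missing-≢o x x≡ o≡ = let j , eq = neutral-leaf x x≡ in missing-≢ x j (trans (sym o≡) (sym eq))

    -- Below each of the two siblings the k missing colours are distinct and avoid `o`, so both
    -- families run through all non-neutral colours.
    aligned : ∃[ τ ] (∀ j → missing ((τ ⟨$⟩ʳ j) ∷ suc zero ∷ u) ≡ missing (j ∷ zero ∷ u))
    aligned = injections-match _ _ (missing-injective _ w≡) (missing-injective _ w≡) o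
      (λ i → missing-≢o _ w≡) (λ i → missing-≢o _ w≡)

    τ = proj₁ aligned

    same-missing : ∀ j →
      ∃[ ρ ] (∀ i → leaf-colour ((τ ⟨$⟩ʳ j) ∷ suc zero ∷ u) (ρ ⟨$⟩ʳ i) ≡ leaf-colour (j ∷ zero ∷ u) i)
    same-missing j = match _ _ w≡ w≡ (sym (proj₂ aligned j))

    -- First pair the groups that miss the same colour, then pair the equally coloured leaves within
    -- them.
    P : Word k → Permutation′ k
    P []          = τ
    P (j ∷ [])    = proj₁ (same-missing j)
    P (_ ∷ _ ∷ _) = idₚ

IsFix-unique : ∀ {G a b} → IsFix G a → IsFix G b → a ≡ b
IsFix-unique (pa , a≤) (pb , b≤) = ≤-antisym (a≤ _ pb) (b≤ _ pa)

-- Palettes for groups of sibling leaves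

-- The i-th group of leaves uses the neutral colour and every other colour but the i-th.
omitOne : ∀ {q} → Fin (suc q) → Fin (suc q) → Fin (suc (suc q))
omitOne t zero    = zero
omitOne t (suc j) = suc (punchIn t j)

omitOne-injective : ∀ {q} (t : Fin (suc q)) → Inj (omitOne t)
omitOne-injective t {zero}  {zero}  _  = refl
omitOne-injective t {suc i} {suc j} eq = cong suc (punchIn-injective t i j (sucᶠ-injective eq))

omitOne-misses : ∀ {q} (t i : Fin (suc q)) → omitOne t i ≢ suc t
omitOne-misses t (suc j) eq = punchInᵢ≢i t j (sucᶠ-injective eq)

omitOne-hits : ∀ {q} {t u : Fin (suc q)} → t ≢ u → ∃[ i ] omitOne t i ≡ suc u
omitOne-hits t≢u = suc (punchOut t≢u) , cong suc (punchIn-punchOut t≢u)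

-- If `t` and `u` differed, the palette of `t` would contain `suc u`, which that of `u` misses.
omitOne-determines : ∀ {q} (t u : Fin (suc q)) → (∀ i → ∃[ j ] omitOne t i ≡ omitOne u j) → t ≡ u
omitOne-determines t u match = decidable-stable (t ≟ᶠ u) λ t≢u →
  let i , hit = omitOne-hits t≢u
      j , eq  = match i
  in omitOne-misses u j (trans (sym eq) hit)

-- A function on types without fixed points or 2-cycles, so that the pairs {t , partner t} are distinct.
partner : ∀ {q} → Fin (suc (suc (suc q))) → Fin (suc (suc (suc q)))
partner zero                = suc (suc zero)
partner (suc zero)          = zero
partner (suc (suc zero))    = suc zero
partner (suc (suc (suc _))) = zero

partner-≢ : ∀ {q} (t : Fin (suc (suc (suc q)))) → t ≢ partner t
partner-≢ zero                ()
partner-≢ (suc zero)          ()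
partner-≢ (suc (suc zero))    ()
partner-≢ (suc (suc (suc _))) ()

partner²-≢ : ∀ {q} (t : Fin (suc (suc (suc q)))) → partner (partner t) ≢ t
partner²-≢ zero                ()
partner²-≢ (suc zero)          ()
partner²-≢ (suc (suc zero))    ()
partner²-≢ (suc (suc (suc _))) ()

-- A group uses k - 1 of the k + 1 non-neutral colours, so its type is encoded by the omitted pair
-- `t`, `partner t`.
omitTwo : ∀ {q} → Fin (suc (suc (suc q))) → Fin (suc (suc q)) → Fin (suc (suc (suc (suc q))))
omitTwo t zero    = zero
omitTwo t (suc j) = suc (punchIn t (punchIn (punchOut (partner-≢ t)) j))

omitTwo-injective : ∀ {q} (t : Fin (suc (suc (suc q)))) → Inj (omitTwo t)
omitTwo-injective t {zero}  {zero}  _  = refl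
omitTwo-injective t {suc i} {suc j} eq =
  cong suc (punchIn-injective (punchOut (partner-≢ t)) i j (punchIn-injective t _ _ (sucᶠ-injective eq)))

omitTwo-misses : ∀ {q} (t : Fin (suc (suc (suc q)))) i → omitTwo t i ≢ suc t
omitTwo-misses t (suc j) eq = punchInᵢ≢i t _ (sucᶠ-injective eq)

omitTwo-misses-partner : ∀ {q} (t : Fin (suc (suc (suc q)))) i → omitTwo t i ≢ suc (partner t)
omitTwo-misses-partner t (suc j) eq = punchInᵢ≢i (punchOut (partner-≢ t)) j
  (punchIn-injective t _ _ (trans (sucᶠ-injective eq) (sym (punchIn-punchOut (partner-≢ t)))))

omitTwo-hits : ∀ {q} {t u : Fin (suc (suc (suc q)))} → t ≢ u → partner t ≢ u → ∃[ i ] omitTwo t i ≡ suc u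
omitTwo-hits {t = t} {u} t≢u p≢u = suc (punchOut ≢) ,
  cong suc (trans (cong (punchIn t) (punchIn-punchOut ≢)) (punchIn-punchOut t≢u))
  where
  ≢ : punchOut (partner-≢ t) ≢ punchOut t≢u
  ≢ eq = p≢u (punchOut-injective (partner-≢ t) t≢u eq)

-- If `t` differed from `u`, then since `t` must omit both `u` and `partner u`, the first would be
-- `partner t` and the second `t`: a 2-cycle of `partner`.
omitTwo-determines : ∀ {q} (t u : Fin (suc (suc (suc q)))) → (∀ i → ∃[ j ] omitTwo t i ≡ omitTwo u j) → t ≡ u
omitTwo-determines t u match = decidable-stable (t ≟ᶠ u) λ t≢u →
  let pt≡u  = decidable-stable (partner t ≟ᶠ u) λ pt≢u → omitted t≢u pt≢u (omitTwo-misses u)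
      pt≡pu = λ t≢pu → decidable-stable (partner t ≟ᶠ partner u) λ pt≢pu →
                omitted t≢pu pt≢pu (omitTwo-misses-partner u)
      t≡pu  = decidable-stable (t ≟ᶠ partner u) λ t≢pu → partner-≢ u (trans (sym pt≡u) (pt≡pu t≢pu))
  in partner²-≢ t (trans (cong partner pt≡u) (sym t≡pu))
  where
  omitted : ∀ {z} → t ≢ z → partner t ≢ z → (∀ j → omitTwo u j ≢ suc z) → ⊥
  omitted t≢z pt≢z misses =
    let i , hit = omitTwo-hits t≢z pt≢z
        j , eq  = match i
    in misses j (trans (sym eq) hit)

punchIn-determines : ∀ {k} (t u : Fin (suc k)) → (∀ i → ∃[ j ] punchIn t i ≡ punchIn u j) → t ≡ u
punchIn-determines t u match = decidable-stable (t ≟ᶠ u) λ t≢u →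
  let j , eq = match (punchOut t≢u)
  in punchInᵢ≢i u j (trans (sym eq) (punchIn-punchOut t≢u))

-- Colourings attaining the bounds

module Colourings {q m : ℕ} {T : Graph} (A : Addressing (suc (suc q)) (suc m) T) where
  open Addressing A
  open Automorphisms A
  open Frugal A

  byIndex : Word k → Fin k
  byIndex []      = zero
  byIndex (i ∷ _) = i

  -- Siblings get different colours, so being fixed passes from the root down to every vertex.
  byIndex-distinguishing : Distinguishing T (byIndex ∘ code)
  byIndex-distinguishing = distinguishing byIndex (λ x y → byIndex x ≡ byIndex y)
    (λ _ _ _ _ same _ → same) (λ _ _ _ _ same → same)

  isDist : IsDist T k
  isDist = (_ , byIndex-distinguishing) , λ d (c , dist) → Coloured.k≤d c dist

  -- `coloured` leaves at most N vertices of nonzero colour, and these form a fixing set, so there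
  -- are exactly N. The one colouring thus yields both the fixing number and the paint cost.
  isFrugal : ∀ {d} → k ≤ suc d → (col : Word k → Fin (suc d)) → Distinguishing T (col ∘ code) →
    (∀ x → length x ≤ n → col x ≢ zero → ∃₂ λ j y → x ≡ suc j ∷ y × length y ≡ m) →
    (∀ d′ → (c : Coloring T d′) → Distinguishing T c → ∀ i → ∣ ∁ (colorClass T c i) ∣ ≡ N → suc d ≤ d′) →
    IsFdist T (suc d)
  isFrugal {d} k≤ col dist coloured least =
    (N , ((k , isDist , k≤) , (_ , dist , zero , minimal) , λ { _ (c , dist′ , i , refl) → bound c dist′ i }) , isFix) ,
    λ { d′ (r , (_ , (c , dist′ , i , eq) , _) , fix) → least d′ c dist′ i (trans eq (IsFix-unique {T} fix isFix)) }
    where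
    open ColourClasses {T} (col ∘ code) zero

    bound : ∀ {d} (c : Coloring T d) → Distinguishing T c → ∀ i → N ≤ ∣ ∁ (colorClass T c i) ∣
    bound c dist i = Fixing.N≤∣S∣ _ (ColourClasses.∁class-fixing {T} c i dist)

    leaf : Fin (k ^ m) → Fin (suc q) → Vertex T
    leaf s j = vert (suc j ∷ group s)

    cover : ∀ {v} → v ∈ ∁ (colorClass T (col ∘ code) zero) →
      ∃[ t ] leaf (proj₁ (remQuot {k ^ m} (suc q) t)) (proj₂ (remQuot {k ^ m} (suc q) t)) ≡ v
    cover {v} v∈ =
      let j , y , eq , y≡ = coloured (code v) (code-length v) (∈∁class⁻ v∈)
          s , s≡          = wordAt-onto k m y y≡
      in combine s j , trans (cong (λ (s , j) → leaf s j) (remQuot-combine s j))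
           (trans (cong (λ y → vert (suc j ∷ y)) s≡) (trans (cong vert (sym eq)) (vert-code v)))

    minimal : ∣ ∁ (colorClass T (col ∘ code) zero) ∣ ≡ N
    minimal = ≤-antisym (cover⇒≤ _ _ cover) (bound _ dist zero)

    isFix : IsFix T N
    isFix = (_ , ∁class-fixing dist , minimal) , λ { _ (S , fixing , refl) → Fixing.N≤∣S∣ S fixing }

  -- Only leaves are coloured, and the colours of a group of sibling leaves
  -- depend on the type of their parent.
  module Layered {L : Set} {d} (type : Word k → L) (palette : L → Fin k → Fin (suc d)) where

    col : Word k → Fin (suc d)
    col []      = zero
    col (i ∷ x) with length x ≟ m
    ... | yes _ = palette (type x) i
    ... | no _  = zero

    col-leaf : ∀ i x → length x ≡ m → col (i ∷ x) ≡ palette (type x) i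
    col-leaf i x eq with length x ≟ m
    ... | yes _ = refl
    ... | no ≢  = contradiction eq ≢

    coloured-leaf : (∀ t → palette t zero ≡ zero) → ∀ x → col x ≢ zero → ∃₂ λ j y → x ≡ suc j ∷ y × length y ≡ m
    coloured-leaf blank []      ≢0 = contradiction refl ≢0
    coloured-leaf blank (i ∷ x) ≢0 with length x ≟ m
    ... | no _ = contradiction refl ≢0
    coloured-leaf blank (zero ∷ x)  ≢0 | yes eq = contradiction (blank (type x)) ≢0
    coloured-leaf blank (suc j ∷ x) ≢0 | yes eq = j , x , refl , eq

    -- Leaf colours reveal the types of their parents, and types of children reveal the type above,
    -- so types are preserved. Siblings differ in type or, as leaves, in colour.
    layered-distinguishing :
      (∀ x y → length x ≡ m → length y ≡ m →
        (∀ i → ∃[ j ] palette (type x) i ≡ palette (type y) j) → type x ≡ type y) →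
      (∀ x y → length x ≡ length y → length x < m →
        (∀ i → ∃[ j ] type (i ∷ x) ≡ type (j ∷ y)) → type x ≡ type y) →
      (∀ x → length x ≡ m → Inj (palette (type x))) →
      (∀ x i j → type (i ∷ x) ≡ type (j ∷ x) → i ≡ j) →
      Distinguishing T (col ∘ code)
    layered-distinguishing at-leaves inside palette-inj type-inj = distinguishing col R up separates
      where
      -- Leaves are compared by colour, inner vertices by type.
      R : Word k → Word k → Set
      R x y = (length x ≡ n → col x ≡ col y) × (length x < n → type x ≡ type y)

      up : ∀ x y → length x ≡ length y → length x ≤ n → col x ≡ col y →
        (length x < n → ∀ i → ∃[ j ] R (i ∷ x) (j ∷ y)) → R x y
      up x y x≡y _ same below = (λ _ → same) , types
        where
        types : length x < n → type x ≡ type y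
        types lt@(s≤s x≤m) with m≤n⇒m<n∨m≡n x≤m
        ... | inj₁ x<m = inside x y x≡y x<m λ i → let j , _ , eq = below lt i in j , eq (s≤s x<m)
        ... | inj₂ x≡m = at-leaves x y x≡m y≡m λ i → let j , eq , _ = below lt i in
          j , trans (sym (col-leaf i x x≡m)) (trans (eq (cong suc x≡m)) (col-leaf j y y≡m))
          where y≡m = trans (sym x≡y) x≡m

      separates : ∀ x i j → suc (length x) ≤ n → R (i ∷ x) (j ∷ x) → i ≡ j
      separates x i j (s≤s x≤m) (cols , types) with m≤n⇒m<n∨m≡n x≤m
      ... | inj₁ x<m = type-inj x i j (types (s≤s x<m))
      ... | inj₂ x≡m = palette-inj x x≡m
        (trans (sym (col-leaf i x x≡m)) (trans (cols (cong suc x≡m)) (col-leaf j x x≡m)))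

  depth-one : m ≡ 0 → IsFdist T k
  depth-one m≡0 = isFrugal ≤-refl byIndex byIndex-distinguishing coloured λ d c dist _ _ → Coloured.k≤d c dist
    where
    coloured : ∀ x → length x ≤ n → byIndex x ≢ zero → ∃₂ λ j y → x ≡ suc j ∷ y × length y ≡ m
    coloured []          _        ≢0 = contradiction refl ≢0
    coloured (zero ∷ _)  _        ≢0 = contradiction refl ≢0
    coloured (suc j ∷ y) (s≤s y≤) _  = j , y , refl , ≤-antisym y≤ (subst (_≤ length y) (sym m≡0) z≤n)

  omitOneFrom : Word k → Fin k → Fin (suc k)
  -- A filler value: for n = 2 the root is not the parent of a leaf.
  omitOneFrom []      _ = zero
  omitOneFrom (t ∷ _) i = omitOne t i

  depth-two : m ≡ 1 → IsFdist T (suc k)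
  depth-two m≡1 = isFrugal (n≤1+n k) col
    (layered-distinguishing at-leaves inside palette-inj (λ _ _ _ → ∷-injectiveˡ))
    (λ x _ → coloured-leaf (λ { [] → refl ; (_ ∷ _) → refl }) x)
    λ d c dist i minimal → more-than-k A c dist i minimal (≤-reflexive (sym m≡1))
    where
    -- Each word serves as its own type; for a parent of leaves its only letter selects the palette.
    open Layered (λ x → x) omitOneFrom
    at-leaves : ∀ x y → length x ≡ m → length y ≡ m → (∀ i → ∃[ j ] omitOneFrom x i ≡ omitOneFrom y j) → x ≡ y
    at-leaves (t ∷ []) (u ∷ []) _ _ match = cong (_∷ []) (omitOne-determines t u match)
    at-leaves [] _ eq _ _ = contradiction (trans eq m≡1) λ ()
    at-leaves (_ ∷ []) [] _ eq _ = contradiction (trans eq m≡1) λ ()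
    at-leaves (_ ∷ []) (_ ∷ _ ∷ _) _ eq _ = contradiction (trans eq m≡1) λ ()
    at-leaves (_ ∷ _ ∷ _) _ eq _ _ = contradiction (trans eq m≡1) λ ()
    inside : ∀ x y → length x ≡ length y → length x < m → (∀ i → ∃[ j ] i ∷ x ≡ j ∷ y) → x ≡ y
    inside _ _ _ _ match = ∷-injectiveʳ (proj₂ (match zero))
    palette-inj : ∀ x → length x ≡ m → Inj (omitOneFrom x)
    palette-inj []      eq = contradiction (trans eq m≡1) λ ()
    palette-inj (t ∷ _) _  = omitOne-injective t

  -- Each of the k + 1 types of inner vertices has children of all types but its own.
  type : Word k → Fin (suc k)
  type []      = zero
  type (i ∷ x) = punchIn (type x) i

  deep : 2 ≤ m → IsFdist T (suc (suc k))
  deep 2≤m@(s≤s (s≤s {n = m′} _)) = isFrugal (≤-trans (n≤1+n k) (n≤1+n (suc k))) col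
    (layered-distinguishing
      (λ x y _ _ → omitTwo-determines (type x) (type y))
      (λ x y _ _ → punchIn-determines (type x) (type y))
      (λ x _ → omitTwo-injective (type x))
      (λ x i j → punchIn-injective (type x) i j))
    (λ x _ → coloured-leaf (λ _ → refl) x)
    least
    where
    open Layered type omitTwo
    least : ∀ d → (c : Coloring T d) → Distinguishing T c → ∀ i →
      ∣ ∁ (colorClass T c i) ∣ ≡ N → suc (suc k) ≤ d
    least d c dist i minimal with m≤n⇒m<n∨m≡n (more-than-k A c dist i minimal (<⇒≤ 2≤m))
    ... | inj₁ lt   = lt
    -- The case of k + 1 colours; here m′ = m - 2, so the all-zero word has the depth needed to
    -- refute it.
    ... | inj₂ refl = contradiction (cong (2 +_) (length-replicate m′))
      (not-suc-k A c dist i minimal (replicate m′ zero))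

theorem2 : ∀ (k n : ℕ) → 2 ≤ k → 1 ≤ n →
    ∀ (T : Graph) → IsPerfectTree k n T →
    (n ≡ 1 → IsFdist T k) ×
    (n ≡ 2 → IsFdist T (k + 1)) ×
    (3 ≤ n → IsFdist T (k + 2))
theorem2 k n 2≤k@(s≤s (s≤s _)) 1≤n@(s≤s _) T perfect =
  depth-one ∘ suc-injective ,
  subst (IsFdist T) (+-comm 1 k) ∘ depth-two ∘ suc-injective ,
  subst (IsFdist T) (+-comm 2 k) ∘ deep ∘ s≤s⁻¹
  where open Colourings (Address.addressing 2≤k 1≤n T perfect)
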